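{- The normal modal logics $\mathbf{K}$ and $\mathbf{KB}$ enjoy the uniform Lyndon interpolation property (ULIP). Moreover, for $L\in\{\mathbf{K},\mathbf{KB}\}$, for any formula $\varphi$ and any finite sets $P,Q$ of propositional variables, there exists a uniform Lyndon interpolant $\theta$ of $(\varphi,P,Q)$ in $L$ with $d(\theta)\le d(\varphi)$.
   Context: Formulas are built from countably many propositional variables, the constant $\bot$ and the connectives $\to$ and $\Box$ ($\neg,\land,\top,\Diamond$ are abbreviations). The modal depth is defined by $d(p)=d(\bot)=0$, $d(\varphi\to\psi)=\max\{d(\varphi),d(\psi)\}$, $d(\Box\varphi)=d(\varphi)+1$. The sets $v^+(\varphi)$, $v^-(\varphi)$ of variables occurring positively/negatively are defined by: $v^+(p)=\{p\}$, $v^-(p)=\emptyset$; $v^\pm(\bot)=\emptyset$; $v^+(\psi\to\theta)=v^-(\psi)\cup v^+(\theta)$, $v^-(\psi\to\theta)=v^+(\psi)\cup v^-(\theta)$; $v^\pm(\Box\psi)=v^\pm(\psi)$. A normal logic is a set of formulas containing all propositional tautologies and $\Box(p\to q)\to(\Box p\to\Box q)$, closed under modus ponens, necessitation and uniform substitution; $L\vdash\varphi$ means $\varphi\in L$. $\mathbf{K}$ is the least normal logic, and for a set $X$ of formulas $\mathbf{K}+X$ is the least normal logic containing $X$; $\mathbf{KB}=\mathbf{K}+\{p\to\Box\Diamond p\}$. For a normal logic $L$, a formula $\varphi$ and finite sets $P,Q$ of variables, a uniform Lyndon interpolant of $(\varphi,P,Q)$ in $L$ is a formula $\theta$ with $v^+(\theta)\subseteq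 v^+(\varphi)\setminus P$, $v^-(\theta)\subseteq v^-(\varphi)\setminus Q$, $L\vdash\varphi\to\theta$, and such that for every formula $\psi$ with $v^+(\psi)\cap P=v^-(\psi)\cap Q=\emptyset$ and $L\vdash\varphi\to\psi$ we have $L\vdash\theta\to\psi$. $L$ enjoys ULIP if such an interpolant exists for every $\varphi$ and all finite $P,Q$. -}

module Defs where

open import Data.Nat using (ℕ; _⊔_; suc; _≤_)
open import Data.Bool using (Bool; true; false; if_then_else_)
open import Data.List using (List)
open import Data.List.Membership.Propositional using (_∈_)
open import Data.Product using (Σ; _×_)
open import Data.Empty using (⊥)
open import Relation.Nullary using (¬_)
open import Relation.Binary.PropositionalEquality using (_≡_)

data Fml : Set where
  var : ℕ → Fml
  bot : Fml
  _⇒_ : Fml → Fml → Fml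
  □_  : Fml → Fml

infixr 5 _⇒_

neg : Fml → Fml
neg φ = φ ⇒ bot

◇_ : Fml → Fml
◇ φ = neg (□ (neg φ))

depth : Fml → ℕ
depth (var _) = 0
depth bot = 0
depth (φ ⇒ ψ) = depth φ ⊔ depth ψ
depth (□ φ) = suc (depth φ)

mutual
  data Pos (p : ℕ) : Fml → Set where
    pos-var : Pos p (var p)
    pos-⇒l  : ∀ {φ ψ} → Neg p φ → Pos p (φ ⇒ ψ)
    pos-⇒r  : ∀ {φ ψ} → Pos p ψ → Pos p (φ ⇒ ψ)
    pos-□   : ∀ {φ} → Pos p φ → Pos p (□ φ)

  data Neg (p : ℕ) : Fml → Set where
    neg-⇒l : ∀ {φ ψ} → Pos p φ → Neg p (φ ⇒ ψ)
    neg-⇒r : ∀ {φ ψ} → Neg p ψ → Neg p (φ ⇒ ψ)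
    neg-□  : ∀ {φ} → Neg p φ → Neg p (□ φ)

-- Propositional tautologies: formulas true under every Boolean valuation
-- of the variables and of the boxed subformulas (treated as atoms).
imp : Bool → Bool → Bool
imp a b = if a then b else true

eval : (ℕ → Bool) → (Fml → Bool) → Fml → Bool
eval v w (var p) = v p
eval v w bot = false
eval v w (φ ⇒ ψ) = imp (eval v w φ) (eval v w ψ)
eval v w (□ φ) = w φ

Tautology : Fml → Set
Tautology φ = ∀ (v : ℕ → Bool) (w : Fml → Bool) → eval v w φ ≡ true

sub : (ℕ → Fml) → Fml → Fml
sub σ (var p) = σ p
sub σ bot = bot
sub σ (φ ⇒ ψ) = sub σ φ ⇒ sub σ ψ
sub σ (□ φ) = □ (sub σ φ)

data _⊢_ (X : Fml → Set) : Fml → Set where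
  taut : ∀ {φ} → Tautology φ → X ⊢ φ
  axK  : X ⊢ (□ (var 0 ⇒ var 1) ⇒ (□ (var 0) ⇒ □ (var 1)))
  ax   : ∀ {φ} → X φ → X ⊢ φ
  mp   : ∀ {φ ψ} → X ⊢ (φ ⇒ ψ) → X ⊢ φ → X ⊢ ψ
  nec  : ∀ {φ} → X ⊢ φ → X ⊢ (□ φ)
  usub : ∀ {φ} (σ : ℕ → Fml) → X ⊢ φ → X ⊢ sub σ φ

NoAx : Fml → Set
NoAx _ = ⊥

BAx : Fml → Set
BAx φ = φ ≡ (var 0 ⇒ □ (◇ (var 0)))

data Logic : Set where
  K KB : Logic

axiomsOf : Logic → Fml → Set
axiomsOf K = NoAx
axiomsOf KB = BAx

_⊩_ : Logic → Fml → Set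
L ⊩ φ = axiomsOf L ⊢ φ

IsULI : Logic → Fml → List ℕ → List ℕ → Fml → Set
IsULI L φ P Q θ =
  (∀ p → Pos p θ → Pos p φ × ¬ (p ∈ P)) ×
  (∀ p → Neg p θ → Neg p φ × ¬ (p ∈ Q)) ×
  (L ⊩ (φ ⇒ θ)) ×
  (∀ ψ → (∀ p → Pos p ψ → ¬ (p ∈ P)) → (∀ p → Neg p ψ → ¬ (p ∈ Q)) →
     L ⊩ (φ ⇒ ψ) → L ⊩ (θ ⇒ ψ))

ULIP : Logic → Set
ULIP L = ∀ (φ : Fml) (P Q : List ℕ) → Σ Fml (IsULI L φ P Q)

{-# OPTIONS --safe #-}
module Submission where

-- Filtering through the subformulas of φ gives finitely many atoms a, each
-- either refutable or satisfied in a finite L-model. By recursion on k let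
-- θ k a say that the permitted literals of a hold, that every successor satisfies
-- θ (k - 1) b for some b accessible from a, and that for each □χ failing at a some
-- successor satisfies θ (k - 1) b for some such b refuting χ. The interpolant is the
-- disjunction of θ (depth φ) a over the atoms a containing φ. If it held at a world
-- v of a model refuting ψ, then pairing worlds of that model with atoms, for
-- depth φ steps from (a , v), would yield a model of φ whose worlds are simulated
-- by those of the given one in the variables of ψ, so φ → ψ would not be derivable.
-- The levels count distance in both directions, which keeps the pairing symmetric.

open import Defs
open import Data.Nat using (_≤_)
open import Data.List using (List)
open import Data.Product using (Σ; _×_)
open import Data.Nat using (ℕ)

open import Data.Bool using (Bool; true; false; if_then_else_)
import Data.Bool.Properties as Bool
open import Data.Empty using (⊥; ⊥-elim)
open import Data.List using ([]; _∷_; _++_; map; filter; length)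
open import Data.List.Membership.DecPropositional as DecMembership using ()
open import Data.List.Membership.Propositional using (_∈_; find; lose)
open import Data.List.Membership.Propositional.Properties
  using (∈-map⁺; ∈-map⁻; ∈-++⁺ˡ; ∈-++⁺ʳ; ∈-++⁻; ∈-filter⁺; ∈-filter⁻)
open import Data.List.Properties using (filter-notAll)
open import Data.List.Relation.Binary.Subset.Propositional using (_⊆_)
open import Data.List.Relation.Unary.All as All using (All)
open import Data.List.Relation.Unary.All.Properties using (¬All⇒Any¬)
open import Data.List.Relation.Unary.Any as Any using (Any; here; there)
open import Data.Nat using (zero; suc; z≤n; s≤s; s≤s⁻¹; _≟_)
open import Data.Nat.Properties
  using (≤-refl; ≤-trans; ⊔-lub; m≤m⊔n; m≤n⊔m; n≤1+n)
open import Data.Product using (∃; _,_; proj₁; proj₂; uncurry)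
open import Data.Sum using (_⊎_; inj₁; inj₂; [_,_]; swap)
open import Data.Unit using (⊤; tt)
open import Function using (_∘_; const; id)
open import Relation.Binary.Definitions using (DecidableEquality; Symmetric)
open import Relation.Binary.PropositionalEquality
  using (_≡_; _≢_; refl; sym; trans; cong; cong₂; subst)
open import Relation.Nullary
  using (¬_; Dec; yes; no; does; Stable; contradiction; map′; _×-dec_; _→-dec_; ¬?)
open import Relation.Nullary.Decidable using (decidable-stable; ¬¬-excluded-middle)

private variable
  X : Fml → Set
  x y z γ : Fml
  xs : List Fml

-- Formula equality, finite connectives and Boolean truth.

infix 4 _≟F_

_≟F_ : DecidableEquality Fml
var p ≟F var q = map′ (cong var) (λ { refl → refl }) (p ≟ q)
bot ≟F bot = yes refl
(x ⇒ y) ≟F (x₁ ⇒ y₁) =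
  map′ (uncurry (cong₂ _⇒_)) (λ { refl → refl , refl }) (x ≟F x₁ ×-dec y ≟F y₁)
(□ x) ≟F (□ y) = map′ (cong □_) (λ { refl → refl }) (x ≟F y)
var _ ≟F bot = no λ ()
var _ ≟F (_ ⇒ _) = no λ ()
var _ ≟F (□ _) = no λ ()
bot ≟F var _ = no λ ()
bot ≟F (_ ⇒ _) = no λ ()
bot ≟F (□ _) = no λ ()
(_ ⇒ _) ≟F var _ = no λ ()
(_ ⇒ _) ≟F bot = no λ ()
(_ ⇒ _) ≟F (□ _) = no λ ()
(□ _) ≟F var _ = no λ ()
(□ _) ≟F bot = no λ ()
(□ _) ≟F (_ ⇒ _) = no λ ()

⋀ : List Fml → Fml
⋀ [] = neg bot
⋀ (x ∷ xs) = neg (x ⇒ neg (⋀ xs))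

⋁ : List Fml → Fml
⋁ [] = bot
⋁ (x ∷ xs) = neg x ⇒ ⋁ xs

-- Only the values at variables and boxed formulas matter.
Atom : Set
Atom = Fml → Bool

infix 4 _⊨_ _⊨?_

record _⊨_ (g : Atom) (χ : Fml) : Set where
  constructor holds
  field eval-true : eval (g ∘ var) (g ∘ □_) χ ≡ true
open _⊨_

_⊨?_ : ∀ g χ → Dec (g ⊨ χ)
g ⊨? χ = map′ holds eval-true (eval (g ∘ var) (g ∘ □_) χ Bool.≟ true)

⊨-⊥ : ∀ {g} → ¬ (g ⊨ bot)
⊨-⊥ (holds ())

⊨-⇒ : ∀ {g} → (g ⊨ x → g ⊨ y) → g ⊨ x ⇒ y
⊨-⇒ {x} {g = g} h with eval (g ∘ var) (g ∘ □_) x in eq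
... | true = holds (trans (cong (λ b → imp b _) eq) (eval-true (h (holds eq))))
... | false = holds (cong (λ b → imp b _) eq)

⊨-mp : ∀ {g} → g ⊨ x ⇒ y → g ⊨ x → g ⊨ y
⊨-mp (holds p) (holds q) = holds (trans (sym (cong (λ b → imp b _) q)) p)

els : Fml → List Fml
els (var p) = var p ∷ []
els bot = []
els (x ⇒ y) = els x ++ els y
els (□ x) = □ x ∷ els x

-- Truth under an atom and forcing at a world share this interface. Forcing is stable under double
-- negation but need not be decidable, so `⋁-elim` gives access to a disjunct only inside a
-- refutation.
module Classical (F : Fml → Set) (F-⊥ : ¬ F bot)
  (F-⇒ : ∀ {x y} → (F x → F y) → F (x ⇒ y))
  (F-mp : ∀ {x y} → F (x ⇒ y) → F x → F y)
  (F-stable : ∀ x → Stable (F x)) where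

  neg-intro : ¬ F x → F (neg x)
  neg-intro h = F-⇒ (⊥-elim ∘ h)

  neg-elim : F (neg x) → ¬ F x
  neg-elim h = F-⊥ ∘ F-mp h

  ⋀-elim : F (⋀ xs) → x ∈ xs → F x
  ⋀-elim h (here refl) =
    F-stable _ λ ¬x → neg-elim h (F-⇒ (⊥-elim ∘ ¬x))
  ⋀-elim h (there i) =
    F-stable _ λ ¬x → neg-elim h (F-⇒ λ _ → neg-intro λ all → ¬x (⋀-elim all i))

  ⋀-intro : ∀ xs → (∀ {x} → x ∈ xs → F x) → F (⋀ xs)
  ⋀-intro [] h = F-⇒ id
  ⋀-intro (_ ∷ xs) h =
    neg-intro λ k → neg-elim (F-mp k (h (here refl))) (⋀-intro xs (h ∘ there))

  ⋁-intro : x ∈ xs → F x → F (⋁ xs)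
  ⋁-intro (here refl) h = F-⇒ λ k → contradiction h (neg-elim k)
  ⋁-intro (there i) h = F-⇒ λ _ → ⋁-intro i h

  ⋁-elim : F (⋁ xs) → ¬ (∀ {x} → x ∈ xs → ¬ F x)
  ⋁-elim {[]} h none = F-⊥ h
  ⋁-elim {_ ∷ _} h none = ⋁-elim (F-mp h (neg-intro (none (here refl)))) (none ∘ there)

  agree : ∀ g χ →
    (∀ {e} → e ∈ els χ → (g e ≡ true → F e) × (F e → g e ≡ true)) →
    (g ⊨ χ → F χ) × (F χ → g ⊨ χ)
  agree g (var p) h with to , from ← h (here refl) = to ∘ eval-true , holds ∘ from
  agree g bot h = ⊥-elim ∘ ⊨-⊥ , ⊥-elim ∘ F-⊥
  agree g (x ⇒ y) h
    with x→ , x← ← agree g x (h ∘ ∈-++⁺ˡ)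
       | y→ , y← ← agree g y (h ∘ ∈-++⁺ʳ (els x))
    = (λ k → F-⇒ (y→ ∘ ⊨-mp k ∘ x←)) , (λ k → ⊨-⇒ (y← ∘ F-mp k ∘ x→))
  agree g (□ x) h with to , from ← h (here refl) = to ∘ eval-true , holds ∘ from

module At (g : Atom) =
  Classical (g ⊨_) ⊨-⊥ ⊨-⇒ ⊨-mp (λ χ → decidable-stable (g ⊨? χ))

∈-tail : x ≢ y → x ∈ y ∷ xs → x ∈ xs
∈-tail ne (here p) = contradiction p ne
∈-tail ne (there i) = i

update : Fml → Bool → Atom → Atom
update e b g x = if does (x ≟F e) then b else g x

update-elim : ∀ (B : Bool → Set) e b g x →
  (x ≡ e → B b) → (x ≢ e → B (g x)) → B (update e b g x)
update-elim B e b g x eq ne with x ≟F e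
... | yes p = eq p
... | no p = ne p

-- Derived rules of normal logics.

valid : (∀ g → g ⊨ x) → X ⊢ x
-- The two valuations of `Tautology` merge into one atom, read at variables and at boxed formulas.
valid h = taut λ v w → eval-true (h (λ { (var p) → v p ; (□ χ) → w χ ; _ → false }))

derive₁ : (∀ g → g ⊨ x → g ⊨ y) → X ⊢ x → X ⊢ y
derive₁ h = mp (valid λ g → ⊨-⇒ (h g))

derive₂ : (∀ g → g ⊨ x → g ⊨ y → g ⊨ z) → X ⊢ x → X ⊢ y → X ⊢ z
derive₂ h p = mp (mp (valid λ g → ⊨-⇒ λ p → ⊨-⇒ (h g p)) p)

⇒-trans : X ⊢ (x ⇒ y) → X ⊢ (y ⇒ z) → X ⊢ (x ⇒ z)
⇒-trans = derive₂ λ g p q → ⊨-⇒ (⊨-mp q ∘ ⊨-mp p)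

⇒-const : X ⊢ y → X ⊢ (x ⇒ y)
⇒-const = derive₁ λ g p → ⊨-⇒ (const p)

⇒-absurd : X ⊢ neg x → X ⊢ (x ⇒ y)
⇒-absurd = derive₁ λ g p → ⊨-⇒ λ q → contradiction q (At.neg-elim g p)

⇒-⋀ : (∀ {y} → y ∈ xs → X ⊢ (x ⇒ y)) → X ⊢ (x ⇒ ⋀ xs)
⇒-⋀ {[]} h = valid λ g → ⊨-⇒ λ _ → At.⋀-intro g [] λ ()
⇒-⋀ {x ∷ xs} h = derive₂
  (λ g p q → ⊨-⇒ λ r → At.⋀-intro g (x ∷ xs)
    λ { (here refl) → ⊨-mp p r ; (there i) → At.⋀-elim g (⊨-mp q r) i })
  (h (here refl)) (⇒-⋀ (h ∘ there))

⇒-⋁ : y ∈ xs → X ⊢ (x ⇒ y) → X ⊢ (x ⇒ ⋁ xs)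
⇒-⋁ i = derive₁ λ g p → ⊨-⇒ (At.⋁-intro g i ∘ ⊨-mp p)

⋁-⇒ : (∀ {y} → y ∈ xs → X ⊢ (y ⇒ x)) → X ⊢ (⋁ xs ⇒ x)
⋁-⇒ {[]} h = valid λ g → ⊨-⇒ λ p → contradiction p ⊨-⊥
⋁-⇒ {_ ∷ _} {x = x} h = derive₂
  (λ g p q → ⊨-⇒ λ r → decidable-stable (g ⊨? x) λ ¬x →
    ¬x (⊨-mp q (⊨-mp r (At.neg-intro g (¬x ∘ ⊨-mp p)))))
  (h (here refl)) (⋁-⇒ (h ∘ there))

□-distrib : X ⊢ (□ (x ⇒ y) ⇒ □ x ⇒ □ y)
□-distrib {x = x} {y} = usub (λ { 0 → x ; _ → y }) axK

□-mono : X ⊢ (x ⇒ y) → X ⊢ (□ x ⇒ □ y)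
□-mono p = mp □-distrib (nec p)

⇒-□⋀ : (∀ {y} → y ∈ xs → X ⊢ (x ⇒ □ y)) → X ⊢ (x ⇒ □ ⋀ xs)
⇒-□⋀ {[]} h = ⇒-const (nec (valid λ g → At.⋀-intro g [] λ ()))
⇒-□⋀ {y ∷ xs} h = derive₂ (λ g p q → ⊨-⇒ λ r → ⊨-mp (⊨-mp q r) (⊨-mp p r))
  (⇒-□⋀ (h ∘ there))
  (⇒-trans (h (here refl)) (⇒-trans (□-mono (valid λ g → ⊨-⇒ λ p → ⊨-⇒ λ q →
    At.⋀-intro g (y ∷ xs) λ { (here refl) → p ; (there i) → At.⋀-elim g q i })) □-distrib))

-- The symmetry axiom at `neg x`, with the double negation under the inner box removed. It makes the
-- extra demands of `KB` derivable.
KB-□¬□ : KB ⊩ (neg x ⇒ □ (neg (□ x)))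
KB-□¬□ {x} = ⇒-trans (usub (λ _ → neg x) (ax refl))
  (□-mono (derive₁ (λ g p → ⊨-⇒ λ q → At.neg-intro g λ r → At.neg-elim g q (⊨-mp p r))
    (□-mono (valid λ g → ⊨-⇒ λ p → At.neg-intro g λ q → At.neg-elim g q p))))

-- Kripke models and soundness.

FrameCondition : Logic → {W : Set} → (W → W → Set) → Set
FrameCondition K R = ⊤
FrameCondition KB R = Symmetric R

-- Stability of the valuation is enough for classical forcing. It survives revaluing variables by
-- formulas, whereas decidability is lost once `□` ranges over arbitrary successors.
record Model (L : Logic) : Set₁ where
  field
    W : Set
    _↝_ : W → W → Set
    frame : FrameCondition L _↝_
    V : W → ℕ → Set
    V-stable : ∀ w p → Stable (V w p)

module _ {L : Logic} where
  open Model

  force : (M : Model L) → W M → Fml → Set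
  force M w (var p) = V M w p
  force M w bot = ⊥
  force M w (x ⇒ y) = force M w x → force M w y
  force M w (□ x) = ∀ u → _↝_ M w u → force M u x

  force-stable : ∀ M w χ → Stable (force M w χ)
  force-stable M w (var p) = V-stable M w p
  force-stable M w bot h = h id
  force-stable M w (x ⇒ y) h p = force-stable M w y λ k → h λ f → k (f p)
  force-stable M w (□ x) h u r = force-stable M u x λ k → h λ f → k (f u r)

  module Forcing (M : Model L) (w : W M) =
    Classical (force M w) id id id (force-stable M w)

  revalue : Model L → (ℕ → Fml) → Model L
  revalue M σ = record M
    { V = λ w p → force M w (σ p) ; V-stable = λ w p → force-stable M w (σ p) }

  force-sub : ∀ M σ χ w →
    (force (revalue M σ) w χ → force M w (sub σ χ)) ×
    (force M w (sub σ χ) → force (revalue M σ) w χ)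
  force-sub M σ (var p) w = id , id
  force-sub M σ bot w = id , id
  force-sub M σ (x ⇒ y) w
    with x→ , x← ← force-sub M σ x w | y→ , y← ← force-sub M σ y w
    = (λ f → y→ ∘ f ∘ x←) , (λ f → y← ∘ f ∘ x→)
  force-sub M σ (□ x) w =
    (λ f u r → proj₁ (force-sub M σ x u) (f u r)) ,
    (λ f u r → proj₂ (force-sub M σ x u) (f u r))

-- Forcing need not be decidable, but a tautology only depends on finitely many
-- atomic truth values, which are decided up to double negation.
atom-of : ∀ (F : Fml → Set) xs →
  ¬ ¬ Σ Atom λ g → ∀ {e} → e ∈ xs → (g e ≡ true → F e) × (F e → g e ≡ true)
atom-of F [] k = k (const false , λ ())
atom-of F (x ∷ xs) k = atom-of F xs λ (g , h) → ¬¬-excluded-middle λ d →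
  k (update x (does d) g , λ {e} i → update-elim (λ b → (b ≡ true → F e) × (F e → b ≡ true)) x (does d) g e
      (λ { refl → reflects d }) (λ ne → h (∈-tail ne i)))
  where
  reflects : ∀ {B : Set} (d : Dec B) → (does d ≡ true → B) × (B → does d ≡ true)
  reflects (yes b) = const b , const refl
  reflects (no ¬b) = (λ ()) , (λ b → contradiction b ¬b)

soundness : ∀ {L} → L ⊩ x → ∀ (M : Model L) w → force M w x
soundness {x} (taut t) M w = force-stable M w x λ k → atom-of (force M w) (els x)
  λ (g , h) → k (proj₁ (Forcing.agree M w g x h) (holds (t _ _)))
soundness axK M w f p u r = f u r (p u r)
soundness {L = KB} (ax refl) M w p u r k = k w (Model.frame M r) p
soundness (mp d e) M w = soundness d M w (soundness e M w)
soundness (nec d) M w u r = soundness d M u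
soundness (usub {φ} σ d) M w = proj₁ (force-sub M σ φ w) (soundness d (revalue M σ) w)

-- Boxed subformulas and finite assignments.

boxes : Fml → List Fml
boxes (var p) = []
boxes bot = []
boxes (x ⇒ y) = boxes x ++ boxes y
boxes (□ x) = x ∷ boxes x

boxes⁺ : ∀ φ → □ x ∈ els φ → x ∈ boxes φ
boxes⁺ (var p) (here ())
boxes⁺ (φ ⇒ ψ) i with ∈-++⁻ (els φ) i
... | inj₁ j = ∈-++⁺ˡ (boxes⁺ φ j)
... | inj₂ j = ∈-++⁺ʳ (boxes φ) (boxes⁺ ψ j)
boxes⁺ (□ φ) (here refl) = here refl
boxes⁺ (□ φ) (there i) = there (boxes⁺ φ i)

boxes⁻ : ∀ φ → x ∈ boxes φ → els (□ x) ⊆ els φ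
boxes⁻ (φ ⇒ ψ) i j with ∈-++⁻ (boxes φ) i
... | inj₁ k = ∈-++⁺ˡ (boxes⁻ φ k j)
... | inj₂ k = ∈-++⁺ʳ (els φ) (boxes⁻ ψ k j)
boxes⁻ (□ φ) (here refl) j = j
boxes⁻ (□ φ) (there i) j = there (boxes⁻ φ i j)

signed : Bool → Fml → Fml
signed true x = x
signed false x = neg x

assignments : List Fml → List Atom
assignments [] = const false ∷ []
assignments (e ∷ es) =
  map (update e true) (assignments es) ++ map (update e false) (assignments es)

update-assignments : ∀ {e a} es b → a ∈ assignments es → update e b a ∈ assignments (e ∷ es)
update-assignments es true i = ∈-++⁺ˡ (∈-map⁺ _ i)
update-assignments {e} es false i = ∈-++⁺ʳ (map (update e true) (assignments es)) (∈-map⁺ _ i)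

assignments-complete : ∀ (g : Atom) es →
  ∃ λ a → a ∈ assignments es × (∀ {e} → e ∈ es → a e ≡ g e)
assignments-complete g [] = const false , here refl , λ ()
assignments-complete g (e ∷ es) with a , a∈ , eq ← assignments-complete g es =
  update e (g e) a , update-assignments es (g e) a∈ , λ {x} i →
    update-elim (_≡ g x) e (g e) a x (λ { refl → refl })
      (λ ne → eq (∈-tail ne i))

-- Filtration through subformulas and type elimination.

module Filtration (L : Logic) (φ : Fml) where

  char : Atom → Fml
  char a = ⋀ (map (λ e → signed (a e) e) (els φ))

  char-spec : ∀ {g a e} → g ⊨ char a → e ∈ els φ → (a e ≡ true → g ⊨ e) × (g ⊨ e → a e ≡ true)
  char-spec {g} {a} {e} h i with a e | At.⋀-elim g h (∈-map⁺ (λ e → signed (a e) e) i)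
  ... | true | p = const p , const refl
  ... | false | p = (λ ()) , λ q → contradiction q (At.neg-elim g p)

  char-⇒ : ∀ {a} → els x ⊆ els φ → a ⊨ x → L ⊩ (char a ⇒ x)
  char-⇒ {x} {a} s p = valid λ g → ⊨-⇒ λ h →
    proj₁ (At.agree g a x (char-spec {g} {a} h ∘ s)) p

  char-⇒neg : ∀ {a} → els x ⊆ els φ → ¬ a ⊨ x → L ⊩ (char a ⇒ neg x)
  char-⇒neg {x} {a} s p = valid λ g → ⊨-⇒ λ h →
    At.neg-intro g (p ∘ proj₂ (At.agree g a x (char-spec {g} {a} h ∘ s)))

  Cover : List Atom → Set
  Cover A = L ⊩ ⋁ (map char A)

  cover-assignments : Cover (assignments (els φ))
  cover-assignments = valid covered
    where
    covered : ∀ g → g ⊨ ⋁ (map char (assignments (els φ)))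
    covered g with a , a∈ , eq ← assignments-complete g (els φ) =
      At.⋁-intro g (∈-map⁺ char a∈) (At.⋀-intro g _ signed-true)
      where
      element : ∀ φ {e} → e ∈ els φ → (g e ≡ true → g ⊨ e) × (g ⊨ e → g e ≡ true)
      element (var p) (here refl) = holds , eval-true
      element (x ⇒ y) i = [ element x , element y ] (∈-++⁻ (els x) i)
      element (□ x) (here refl) = holds , eval-true
      element (□ x) (there i) = element x i

      signed-true : x ∈ map (λ e → signed (a e) e) (els φ) → g ⊨ x
      signed-true i with e , e∈ , refl ← ∈-map⁻ _ i rewrite eq e∈
        with g e | element φ e∈
      ... | true | to , _ = to refl
      ... | false | _ , from = At.neg-intro g λ h → contradiction (from h) λ ()

  cover-elim : ∀ {A} → Cover A → (∀ {a} → a ∈ A → L ⊩ (char a ⇒ x)) → L ⊩ x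
  cover-elim c h = mp (⋁-⇒ λ i → case-char (∈-map⁻ char i)) c
    where
    case-char : ∃ (λ a → a ∈ _ × y ≡ char a) → L ⊩ (y ⇒ _)
    case-char (a , a∈ , refl) = h a∈

  -- Everything an atom says, through its boxes, about its successors; for KB
  -- this includes ¬□χ for each χ that fails at the atom.
  demands : Logic → Atom → List Fml
  demands K a = filter (λ χ → a ⊨? □ χ) (boxes φ)
  demands KB a = demands K a ++ map (neg ∘ □_) (filter (λ χ → ¬? (a ⊨? χ)) (boxes φ))

  R : Atom → Atom → Set
  R a b = All (b ⊨_) (demands L a)

  R? : ∀ a b → Dec (R a b)
  R? a b = All.all? (b ⊨?_) (demands L a)

  char-⇒□demand : ∀ {a γ} → γ ∈ demands L a → L ⊩ (char a ⇒ □ γ)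
  char-⇒□demand {a} = go L refl
    where
    boxed : γ ∈ demands K a → L ⊩ (char a ⇒ □ γ)
    boxed i with j , p ← ∈-filter⁻ (λ χ → a ⊨? □ χ) i = char-⇒ (boxes⁻ φ j) p

    -- `L` is fixed by the module, so a copy `L₁` is split instead; the equation lets the second
    -- case use the axiom of `KB`.
    go : ∀ L₁ → L ≡ L₁ → γ ∈ demands L₁ a → L ⊩ (char a ⇒ □ γ)
    go K _ i = boxed i
    go KB refl i with ∈-++⁻ (demands K a) i
    ... | inj₁ j = boxed j
    ... | inj₂ j with χ , k , refl ← ∈-map⁻ _ j
      with l , ¬p ← ∈-filter⁻ (λ χ → ¬? (a ⊨? χ)) k
      = ⇒-trans (char-⇒neg (boxes⁻ φ l ∘ there) ¬p) KB-□¬□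

  els-demand : ∀ {a γ} → γ ∈ demands L a → els γ ⊆ els φ
  els-demand {a} = go L
    where
    boxed : γ ∈ demands K a → els γ ⊆ els φ
    boxed i = boxes⁻ φ (proj₁ (∈-filter⁻ (λ χ → a ⊨? □ χ) i)) ∘ there

    go : ∀ L₁ → γ ∈ demands L₁ a → els γ ⊆ els φ
    go K i = boxed i
    go KB i with ∈-++⁻ (demands K a) i
    ... | inj₁ j = boxed j
    ... | inj₂ j with χ , k , refl ← ∈-map⁻ _ j =
      λ l → boxes⁻ φ (proj₁ (∈-filter⁻ (λ χ → ¬? (a ⊨? χ)) k)) (neg-els l)
      where
      neg-els : ∀ {e} → e ∈ els (neg (□ x)) → e ∈ els (□ x)
      neg-els i = [ id , (λ ()) ] (∈-++⁻ (els (□ _)) i)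

  R-□ : ∀ {a b χ} → R a b → χ ∈ boxes φ → a ⊨ □ χ → b ⊨ χ
  R-□ {a} {b} {χ} r i p = All.lookup r (go L)
    where
    go : ∀ L₁ → χ ∈ demands L₁ a
    go K = ∈-filter⁺ (λ χ → a ⊨? □ χ) i p
    go KB = ∈-++⁺ˡ (∈-filter⁺ (λ χ → a ⊨? □ χ) i p)

  -- `char a` derives `□` of every demand of `a`, so it suffices that `x` follows from these demands
  -- at each atom of the cover. An atom not accessible from `a` falsifies one of them, which makes
  -- its case vacuous.
  box-rule : ∀ {A a} → Cover A →
    (∀ {b} → b ∈ A → R a b → L ⊩ (char b ⇒ x)) → L ⊩ (char a ⇒ □ x)
  box-rule {x} {A} {a} c h =
    ⇒-trans (⇒-□⋀ char-⇒□demand) (□-mono (cover-elim c at))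
    where
    at : ∀ {b} → b ∈ A → L ⊩ (char b ⇒ ⋀ (demands L a) ⇒ x)
    at {b} b∈ with R? a b
    ... | yes r = derive₁ (λ g p → ⊨-⇒ λ q → ⊨-⇒ λ _ → ⊨-mp p q) (h b∈ r)
    ... | no ¬r with γ , γ∈ , ¬γ ← find (¬All⇒Any¬ (b ⊨?_) _ ¬r) =
      derive₁ (λ g p → ⊨-⇒ λ q → ⊨-⇒ λ d →
        contradiction (At.⋀-elim g d γ∈) (At.neg-elim g (⊨-mp p q)))
        (char-⇒neg (els-demand γ∈) ¬γ)

  -- Saturation: what the truth lemma asks of `a` for failing boxes when worlds are taken from `A`.
  Good : List Atom → Atom → Set
  Good A a = All (λ χ → ¬ a ⊨ □ χ → Any (λ b → R a b × ¬ b ⊨ χ) A) (boxes φ)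

  Good? : ∀ A a → Dec (Good A a)
  Good? A a = All.all?
    (λ χ → ¬? (a ⊨? □ χ) →-dec Any.any? (λ b → R? a b ×-dec ¬? (b ⊨? χ)) A) (boxes φ)

  -- Some `□ χ` fails at `a` while `χ` holds at all atoms of `A` accessible from `a`. By `box-rule`,
  -- `char a` derives `□ χ`, and it also derives the negation.
  refute-bad : ∀ {A a} → Cover A → ¬ Good A a → L ⊩ neg (char a)
  refute-bad {A} {a} c bad
    with χ , χ∈ , ¬h ← find (¬All⇒Any¬
      (λ χ → ¬? (a ⊨? □ χ) →-dec Any.any? (λ b → R? a b ×-dec ¬? (b ⊨? χ)) A) _ bad)
    with a ⊨? □ χ
  ... | yes p = contradiction (λ ¬p → contradiction p ¬p) ¬h
  ... | no ¬p = derive₂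
    (λ g p q → At.neg-intro g λ r → At.neg-elim g (⊨-mp q r) (⊨-mp p r))
    (box-rule c at) (char-⇒neg (boxes⁻ φ χ∈) ¬p)
    where
    at : ∀ {b} → b ∈ A → R a b → L ⊩ (char b ⇒ χ)
    at {b} b∈ r with b ⊨? χ
    ... | yes q = char-⇒ (boxes⁻ φ χ∈ ∘ there) q
    ... | no ¬q = contradiction (λ _ → lose b∈ (r , ¬q)) ¬h

  -- Type elimination: discard refutable atoms until every remaining atom has
  -- all the successors it needs.
  prune : ∀ n A → length A ≤ n → Cover A → Σ (List Atom) λ B → Cover B × All (Good B) B
  prune n A ≤n c with All.all? (Good? A) A
  ... | yes good = A , c , good
  prune zero [] _ c | no ¬good = contradiction All.[] ¬good
  prune (suc n) A ≤n c | no ¬good =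
    prune n (filter (Good? A) A)
      (s≤s⁻¹ (≤-trans (filter-notAll (Good? A) A (¬All⇒Any¬ (Good? A) A ¬good)) ≤n))
      (cover-elim c keep)
    where
    keep : ∀ {a} → a ∈ A → L ⊩ (char a ⇒ ⋁ (map char (filter (Good? A) A)))
    keep {a} a∈ with Good? A a
    ... | yes good = ⇒-⋁ (∈-map⁺ char (∈-filter⁺ (Good? A) a∈ good)) (valid λ g → ⊨-⇒ id)
    ... | no bad = ⇒-absurd (refute-bad c bad)

  -- Opaque, so that type checking does not unfold the elimination over exponentially many atoms.
  abstract
    pruned : Σ (List Atom) λ A → Cover A × All (Good A) A
    pruned = prune _ (assignments (els φ)) ≤-refl cover-assignments

  survivors : List Atom
  survivors = proj₁ pruned

  cover : Cover survivors
  cover = proj₁ (proj₂ pruned)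

  witness : ∀ {a χ} → a ∈ survivors → χ ∈ boxes φ → ¬ a ⊨ □ χ →
    ∃ λ b → b ∈ survivors × R a b × ¬ b ⊨ χ
  witness i j ¬p = find (All.lookup (All.lookup (proj₂ (proj₂ pruned)) i) j ¬p)

-- The finite canonical model and completeness.

R-frame : ∀ L φ → FrameCondition L (Filtration.R L φ)
R-frame K φ = tt
R-frame KB φ {a} {b} r = All.tabulate back
  where
  open Filtration KB φ
  -- A box of b failing at a would be refuted by a demand of a on b.
  back : γ ∈ demands KB b → a ⊨ γ
  back i with ∈-++⁻ (demands K b) i
  ... | inj₁ j with k , p ← ∈-filter⁻ (λ χ → b ⊨? □ χ) {xs = boxes φ} j =
    decidable-stable (a ⊨? _) λ ¬q → At.neg-elim b
      (All.lookup r (∈-++⁺ʳ (demands K a)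
        (∈-map⁺ (neg ∘ □_) (∈-filter⁺ (λ χ → ¬? (a ⊨? χ)) k ¬q)))) p
  -- Here the demand is `neg (□ χ)` with `χ` false at `b`; were `□ χ` true at `a`, accessibility
  -- would make `χ` true at `b`.
  ... | inj₂ j with χ , k , refl ← ∈-map⁻ _ j
    with l , ¬p ← ∈-filter⁻ (λ χ → ¬? (b ⊨? χ)) {xs = boxes φ} k =
    At.neg-intro a λ q → ¬p (R-□ r l q)

frame-pullback : ∀ L {A B : Set} {R : A → A → Set} (f : B → A) →
  FrameCondition L R → FrameCondition L (λ b c → R (f b) (f c))
frame-pullback K f fc = tt
frame-pullback KB f fc r = fc r

frame-× : ∀ L {A : Set} {R S : A → A → Set} →
  FrameCondition L R → FrameCondition L S → FrameCondition L (λ x y → R x y × S x y)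
frame-× K _ _ = tt
frame-× KB f g (r , s) = f r , g s

module Canonical (L : Logic) (φ : Fml) where
  open Filtration L φ

  canonical : Model L
  canonical = record
    { W = Σ Atom (_∈ survivors)
    ; _↝_ = λ a b → R (proj₁ a) (proj₁ b)
    ; frame = frame-pullback L {R = R} proj₁ (R-frame L φ)
    ; V = λ a p → proj₁ a ⊨ var p
    ; V-stable = λ a p → decidable-stable (proj₁ a ⊨? var p)
    }

  truth : ∀ χ → els χ ⊆ els φ → ∀ a →
    (proj₁ a ⊨ χ → force canonical a χ) × (force canonical a χ → proj₁ a ⊨ χ)
  truth (var p) s a = id , id
  truth bot s a = ⊨-⊥ , ⊥-elim
  truth (x ⇒ y) s a with x→ , x← ← truth x (s ∘ ∈-++⁺ˡ) a
                       | y→ , y← ← truth y (s ∘ ∈-++⁺ʳ (els x)) a =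
    (λ h → y→ ∘ ⊨-mp h ∘ x←) , (λ h → ⊨-⇒ (y← ∘ h ∘ x→))
  truth (□ x) s (a , a∈) =
    (λ h b r → proj₁ (truth x (s ∘ there) b) (R-□ r (boxes⁺ φ (s (here refl))) h)) ,
    (λ h → decidable-stable (a ⊨? □ x) λ ¬p →
      let b , b∈ , r , ¬q = witness a∈ (boxes⁺ φ (s (here refl))) ¬p
      in ¬q (proj₂ (truth x (s ∘ there) (b , b∈)) (h (b , b∈) r)))

  -- Checking `φ` on the finitely many survivors decides the case: if it holds at all of them, the
  -- cover derives it; a survivor where it fails is itself a refuting world.
  completeness : L ⊩ φ ⊎ Σ (Model L) λ M → ∃ λ w → ¬ force M w φ
  completeness with All.all? (_⊨? φ) survivors
  ... | yes all = inj₁ (cover-elim cover λ i →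
    derive₁ (λ g p → ⊨-⇒ λ q → decidable-stable (g ⊨? φ) λ ¬p → ¬p (⊨-mp p q))
      (char-⇒ id (All.lookup all i)))
  ... | no ¬all with a , a∈ , ¬p ← find (¬All⇒Any¬ (_⊨? φ) survivors ¬all) =
    inj₂ (canonical , (a , a∈) , ¬p ∘ proj₂ (truth φ id (a , a∈)))

-- Signed variables and bounds on signs and depth.

posVars negVars : Fml → List ℕ
posVars (var p) = p ∷ []
posVars bot = []
posVars (x ⇒ y) = negVars x ++ posVars y
posVars (□ x) = posVars x
negVars (var p) = []
negVars bot = []
negVars (x ⇒ y) = posVars x ++ negVars y
negVars (□ x) = negVars x

posVars⁺ : ∀ {p} → Pos p x → p ∈ posVars x
negVars⁺ : ∀ {p} → Neg p x → p ∈ negVars x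
posVars⁺ pos-var = here refl
posVars⁺ (pos-⇒l i) = ∈-++⁺ˡ (negVars⁺ i)
posVars⁺ {x = x ⇒ y} (pos-⇒r i) = ∈-++⁺ʳ (negVars x) (posVars⁺ i)
posVars⁺ (pos-□ i) = posVars⁺ i
negVars⁺ (neg-⇒l i) = ∈-++⁺ˡ (posVars⁺ i)
negVars⁺ {x = x ⇒ y} (neg-⇒r i) = ∈-++⁺ʳ (posVars x) (negVars⁺ i)
negVars⁺ (neg-□ i) = negVars⁺ i

posVars⁻ : ∀ {p} x → p ∈ posVars x → Pos p x
negVars⁻ : ∀ {p} x → p ∈ negVars x → Neg p x
posVars⁻ (var p) (here refl) = pos-var
posVars⁻ (x ⇒ y) i = [ pos-⇒l ∘ negVars⁻ x , pos-⇒r ∘ posVars⁻ y ] (∈-++⁻ (negVars x) i)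
posVars⁻ (□ x) i = pos-□ (posVars⁻ x i)
negVars⁻ (x ⇒ y) i = [ neg-⇒l ∘ posVars⁻ x , neg-⇒r ∘ negVars⁻ y ] (∈-++⁻ (posVars x) i)
negVars⁻ (□ x) i = neg-□ (negVars⁻ x i)

pos-els : ∀ {p} → Pos p x → var p ∈ els x
neg-els : ∀ {p} → Neg p x → var p ∈ els x
pos-els pos-var = here refl
pos-els (pos-⇒l i) = ∈-++⁺ˡ (neg-els i)
pos-els {x = x ⇒ y} (pos-⇒r i) = ∈-++⁺ʳ (els x) (pos-els i)
pos-els (pos-□ i) = there (pos-els i)
neg-els (neg-⇒l i) = ∈-++⁺ˡ (pos-els i)
neg-els {x = x ⇒ y} (neg-⇒r i) = ∈-++⁺ʳ (els x) (neg-els i)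
neg-els (neg-□ i) = there (neg-els i)

record Within (S T : ℕ → Set) (n : ℕ) (χ : Fml) : Set where
  field
    pos⊆ : ∀ p → Pos p χ → S p
    neg⊆ : ∀ p → Neg p χ → T p
    depth≤ : depth χ ≤ n
open Within

module _ {S T : ℕ → Set} where

  within-var : ∀ {n p} → S p → Within S T n (var p)
  within-var s = record { pos⊆ = λ { _ pos-var → s } ; neg⊆ = λ _ () ; depth≤ = z≤n }

  within-bot : ∀ {n} → Within S T n bot
  within-bot = record { pos⊆ = λ _ () ; neg⊆ = λ _ () ; depth≤ = z≤n }

  within-⇒ : ∀ {n} → Within T S n x → Within S T n y → Within S T n (x ⇒ y)
  within-⇒ wx wy = record
    { pos⊆ = λ { p (pos-⇒l i) → neg⊆ wx p i ; p (pos-⇒r i) → pos⊆ wy p i }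
    ; neg⊆ = λ { p (neg-⇒l i) → pos⊆ wx p i ; p (neg-⇒r i) → neg⊆ wy p i }
    ; depth≤ = ⊔-lub (depth≤ wx) (depth≤ wy) }

  within-□ : ∀ {n} → Within S T n x → Within S T (suc n) (□ x)
  within-□ w = record
    { pos⊆ = λ { p (pos-□ i) → pos⊆ w p i }
    ; neg⊆ = λ { p (neg-□ i) → neg⊆ w p i }
    ; depth≤ = s≤s (depth≤ w) }

within-neg : ∀ {S T n} → Within T S n x → Within S T n (neg x)
within-neg w = within-⇒ w within-bot

within-◇ : ∀ {S T n} → Within S T n x → Within S T (suc n) (◇ x)
within-◇ = within-neg ∘ within-□ ∘ within-neg

within-⋀ : ∀ {S T n} xs → (∀ {x} → x ∈ xs → Within S T n x) → Within S T n (⋀ xs)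
within-⋀ [] h = within-neg within-bot
within-⋀ (x ∷ xs) h =
  within-neg (within-⇒ (h (here refl)) (within-neg (within-⋀ xs (h ∘ there))))

within-⋁ : ∀ {S T n} xs → (∀ {x} → x ∈ xs → Within S T n x) → Within S T n (⋁ xs)
within-⋁ [] h = within-bot
within-⋁ (x ∷ xs) h = within-⇒ (within-neg (h (here refl))) (within-⋁ xs (h ∘ there))

-- Construction and verification of the interpolant.

module Interpolant (L : Logic) (φ : Fml) (P Q : List ℕ) where
  open Filtration L φ
  open DecMembership _≟_ using (_∈?_)

  successors : Atom → List Atom
  successors a = filter (R? a) survivors

  successors⁺ : ∀ {a b} → b ∈ survivors → R a b → b ∈ successors a
  successors⁺ {a} = ∈-filter⁺ (R? a)

  successors⁻ : ∀ {a b} → b ∈ successors a → b ∈ survivors × R a b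
  successors⁻ {a} = ∈-filter⁻ (R? a)

  kept⁺? : ∀ a p → Dec (a ⊨ var p × ¬ p ∈ P)
  kept⁺? a p = a ⊨? var p ×-dec ¬? (p ∈? P)

  kept⁻? : ∀ a p → Dec (¬ a ⊨ var p × ¬ p ∈ Q)
  kept⁻? a p = ¬? (a ⊨? var p) ×-dec ¬? (p ∈? Q)

  literals : Atom → List Fml
  literals a = map var (filter (kept⁺? a) (posVars φ)) ++
               map (neg ∘ var) (filter (kept⁻? a) (negVars φ))

  failures : Atom → Fml → List Atom
  failures a χ = filter (λ b → ¬? (b ⊨? χ)) (successors a)

  failures⁻ : ∀ {a b χ} → b ∈ failures a χ → b ∈ survivors × R a b × ¬ b ⊨ χ
  failures⁻ {χ = χ} i with j , ¬p ← ∈-filter⁻ (λ b → ¬? (b ⊨? χ)) i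
    with k , r ← successors⁻ j = k , r , ¬p

  -- A weakened cover modality. A diamond for each accessible atom need not follow from `char a`;
  -- one diamond per failing box, over all accessible atoms refuting its body, does.
  modal : (Atom → Fml) → Atom → List Fml
  modal f a = (□ ⋁ (map f (successors a))) ∷
    map (λ χ → ◇ ⋁ (map f (failures a χ))) (filter (λ χ → ¬? (a ⊨? □ χ)) (boxes φ))

  conjuncts : ℕ → Atom → List Fml
  θ : ℕ → Atom → Fml
  conjuncts zero a = literals a
  conjuncts (suc k) a = literals a ++ modal (θ k) a
  θ k a = ⋀ (conjuncts k a)

  literals-conjuncts : ∀ k {a} → literals a ⊆ conjuncts k a
  literals-conjuncts zero = id
  literals-conjuncts (suc k) = ∈-++⁺ˡ

  S T : ℕ → Set
  S p = Pos p φ × ¬ p ∈ P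
  T p = Neg p φ × ¬ p ∈ Q

  literals-within : ∀ {n x} a → x ∈ literals a → Within S T n x
  literals-within a i with ∈-++⁻ (map var (filter (kept⁺? a) (posVars φ))) i
  ... | inj₁ j with p , k , refl ← ∈-map⁻ var j
    with l , _ , p∉ ← ∈-filter⁻ (kept⁺? a) k = within-var (posVars⁻ φ l , p∉)
  ... | inj₂ j with p , k , refl ← ∈-map⁻ (neg ∘ var) j
    with l , _ , p∉ ← ∈-filter⁻ (kept⁻? a) {xs = negVars φ} k =
    within-neg (within-var (negVars⁻ φ l , p∉))

  modal-within : ∀ {n x} (f : Atom → Fml) a → (∀ b → Within S T n (f b)) →
    x ∈ modal f a → Within S T (suc n) x
  modal-within {n} f a h = go
    where
    ⋁-within : ∀ as → Within S T n (⋁ (map f as))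
    ⋁-within as = within-⋁ (map f as) λ i → image (∈-map⁻ f i)
      where
      image : ∀ {x} → ∃ (λ b → b ∈ as × x ≡ f b) → Within S T n x
      image (b , _ , refl) = h b

    go : ∀ {x} → x ∈ modal f a → Within S T (suc n) x
    go (here refl) = within-□ (⋁-within (successors a))
    go (there i) with χ , _ , refl ← ∈-map⁻ _ i = within-◇ (⋁-within (failures a χ))

  θ-within : ∀ k a → Within S T k (θ k a)
  θ-within zero a = within-⋀ _ (literals-within a)
  θ-within (suc k) a = within-⋀ _ λ i →
    [ literals-within a , modal-within (θ k) a (θ-within k) ] (∈-++⁻ (literals a) i)

  literals-derivable : ∀ a → x ∈ literals a → L ⊩ (char a ⇒ x)
  literals-derivable a i with ∈-++⁻ (map var (filter (kept⁺? a) (posVars φ))) i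
  ... | inj₁ j with p , k , refl ← ∈-map⁻ var j
    with l , h , _ ← ∈-filter⁻ (kept⁺? a) k =
    char-⇒ (λ { (here refl) → pos-els (posVars⁻ φ l) }) h
  ... | inj₂ j with p , k , refl ← ∈-map⁻ (neg ∘ var) j
    with l , h , _ ← ∈-filter⁻ (kept⁻? a) {xs = negVars φ} k =
    char-⇒neg (λ { (here refl) → neg-els (negVars⁻ φ l) }) h

  -- The box conjunct is an instance of `box-rule`. For a diamond, let `D` be the disjunction over
  -- the failures of `χ`: every accessible atom satisfies `χ` or is a failure, so `char a` derives
  -- `□ (neg D ⇒ χ)`. Hence `□ (neg D)` would yield `□ χ`, which `char a` refutes.
  modal-derivable : ∀ (f : Atom → Fml) → (∀ b → L ⊩ (char b ⇒ f b)) →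
    ∀ a → x ∈ modal f a → L ⊩ (char a ⇒ x)
  modal-derivable f h a (here refl) =
    box-rule cover λ {b} b∈ r → ⇒-⋁ (∈-map⁺ f (successors⁺ b∈ r)) (h b)
  modal-derivable f h a (there i) with χ , j , refl ← ∈-map⁻ _ i
    with χ∈ , ¬p ← ∈-filter⁻ (λ χ → ¬? (a ⊨? □ χ)) {xs = boxes φ} j =
    derive₂ (λ g p q → ⊨-⇒ λ c → At.neg-intro g λ b → At.neg-elim g (⊨-mp q c) (⊨-mp (⊨-mp p c) b))
      (⇒-trans (box-rule cover at) □-distrib) (char-⇒neg (boxes⁻ φ χ∈) ¬p)
    where
    at : ∀ {b} → b ∈ survivors → R a b → L ⊩ (char b ⇒ neg (⋁ (map f (failures a χ))) ⇒ χ)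
    at {b} b∈ r with b ⊨? χ
    ... | yes p = derive₁ (λ g q → ⊨-⇒ λ c → ⊨-⇒ λ _ → ⊨-mp q c) (char-⇒ (boxes⁻ φ χ∈ ∘ there) p)
    ... | no ¬p = derive₁ (λ g q → ⊨-⇒ λ c → ⊨-⇒ λ n → contradiction (⊨-mp q c) (At.neg-elim g n))
      (⇒-⋁ (∈-map⁺ f (∈-filter⁺ (λ b → ¬? (b ⊨? χ)) (successors⁺ b∈ r) ¬p)) (h b))

  θ-derivable : ∀ k a → L ⊩ (char a ⇒ θ k a)
  θ-derivable zero a = ⇒-⋀ (literals-derivable a)
  θ-derivable (suc k) a = ⇒-⋀ λ i →
    [ literals-derivable a , modal-derivable (θ k) (θ-derivable k) a ] (∈-++⁻ (literals a) i)

  models : List Atom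
  models = filter (_⊨? φ) survivors

  interpolant : Fml
  interpolant = ⋁ (map (θ (depth φ)) models)

  interpolant-within : Within S T (depth φ) interpolant
  interpolant-within = within-⋁ _ λ i → image (∈-map⁻ _ i)
    where
    image : ∃ (λ a → a ∈ models × x ≡ θ (depth φ) a) → Within S T (depth φ) x
    image (a , _ , refl) = θ-within (depth φ) a

  φ⇒interpolant : L ⊩ (φ ⇒ interpolant)
  φ⇒interpolant = cover-elim cover at
    where
    at : ∀ {a} → a ∈ survivors → L ⊩ (char a ⇒ φ ⇒ interpolant)
    at {a} a∈ with a ⊨? φ
    ... | yes p = derive₁ (λ g q → ⊨-⇒ λ c → ⊨-⇒ λ _ → ⊨-mp q c)
      (⇒-⋁ (∈-map⁺ _ (∈-filter⁺ (_⊨? φ) a∈ p)) (θ-derivable (depth φ) a))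
    ... | no ¬p = derive₁ (λ g q → ⊨-⇒ λ c → ⊨-⇒ λ h → contradiction h (At.neg-elim g (⊨-mp q c)))
      (char-⇒neg id ¬p)

  -- A world pair k a v forces exactly what a says about subformulas of φ up to
  -- depth k, and is simulated by v in the remaining variables; below level 0 the
  -- atom is forgotten and the worlds of N are copied.
  module Amalgam (N : Model L) where
    open Model N

    data World : Set where
      pair : ∀ k a v → a ∈ survivors → force N v (θ k a) → World
      out : W → World

    π : World → W
    π (pair _ _ v _ _) = v
    π (out v) = v

    -- Level steps go both ways, so symmetry of `R` is inherited. Only level 0 borders on the copy
    -- of `N`: there just formulas without boxes are still controlled, so the atom may be dropped.
    Compatible : World → World → Set
    Compatible (pair k a _ _ _) (pair l b _ _ _) = R a b × (k ≡ suc l ⊎ l ≡ suc k)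
    Compatible (pair k _ _ _ _) (out _) = k ≡ 0
    Compatible (out _) (pair k _ _ _ _) = k ≡ 0
    Compatible (out _) (out _) = ⊤

    compatible-frame : ∀ L₁ → FrameCondition L₁ R → FrameCondition L₁ Compatible
    compatible-frame K _ = tt
    compatible-frame KB R-sym {pair _ _ _ _ _} {pair _ _ _ _ _} (r , adj) = R-sym r , swap adj
    compatible-frame KB R-sym {pair _ _ _ _ _} {out _} eq = eq
    compatible-frame KB R-sym {out _} {pair _ _ _ _ _} eq = eq
    compatible-frame KB R-sym {out _} {out _} _ = tt

    -- The atom overrides `N` in one direction per sign: to true at positive variables of `φ`, to
    -- false at negative ones. The negations express a classical disjunction and keep the result
    -- stable.
    value : World → ℕ → Set
    value (pair k a v _ _) p =
      ¬ (¬ a ⊨ var p × Neg p φ) × (¬ (a ⊨ var p × Pos p φ) → V v p)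
    value (out v) p = V v p

    value-stable : ∀ w p → Stable (value w p)
    value-stable (pair k a v _ _) p h =
      (λ n → h λ (f , _) → f n) ,
      (λ n → V-stable v p λ k → h λ (_ , f) → k (f n))
    value-stable (out v) p = V-stable v p

    amalgam : Model L
    amalgam = record
      { W = World
      ; _↝_ = λ x y → π x ↝ π y × Compatible x y
      ; frame = frame-× L {R = λ x y → π x ↝ π y} {Compatible}
          (frame-pullback L {R = _↝_} π frame) (compatible-frame L (R-frame L φ))
      ; V = value
      ; V-stable = value-stable
      }

    conjunct : ∀ k {a v x} → force N v (θ k a) → x ∈ conjuncts k a → force N v x
    conjunct k {a} {v} h i = Forcing.⋀-elim N v {xs = conjuncts k a} h i

    ⋁θ-elim : ∀ {k v as} → force N v (⋁ (map (θ k) as)) →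
      ¬ (∀ {b} → b ∈ as → ¬ force N v (θ k b))
    ⋁θ-elim {k} {v} {as} h none = Forcing.⋁-elim N v {xs = map (θ k) as} h λ i → at (∈-map⁻ (θ k) i)
      where
      at : ∃ (λ b → b ∈ as × x ≡ θ k b) → ¬ force N v x
      at (b , b∈ , refl) = none b∈

    -- Since the valuation follows `a` in one direction per sign, truth and falsity at `a` transfer
    -- under opposite sign conditions, and the two statements swap on the left of an implication.
    atom-forces : ∀ {k a v} a∈ h χ → els χ ⊆ els φ →
      (∀ p → Pos p χ → Pos p φ) → (∀ p → Neg p χ → Neg p φ) → depth χ ≤ k →
      a ⊨ χ → force amalgam (pair k a v a∈ h) χ
    atom-refutes : ∀ {k a v} a∈ h χ → els χ ⊆ els φ →
      (∀ p → Pos p χ → Neg p φ) → (∀ p → Neg p χ → Pos p φ) → depth χ ≤ k →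
      ¬ a ⊨ χ → ¬ force amalgam (pair k a v a∈ h) χ

    atom-forces a∈ h (var p) s p⁺ p⁻ d t =
      (λ (¬t , _) → ¬t t) , (λ n → contradiction (t , p⁺ p pos-var) n)
    atom-forces a∈ h bot s p⁺ p⁻ d t = ⊨-⊥ t
    atom-forces {k} {a} {v} a∈ h (x ⇒ y) s p⁺ p⁻ d t fx with a ⊨? x
    ... | yes t₁ = atom-forces a∈ h y (s ∘ ∈-++⁺ʳ (els x)) (λ p → p⁺ p ∘ pos-⇒r)
      (λ p → p⁻ p ∘ neg-⇒r) (≤-trans (m≤n⊔m (depth x) (depth y)) d) (⊨-mp t t₁)
    ... | no ¬t = contradiction fx (atom-refutes a∈ h x (s ∘ ∈-++⁺ˡ) (λ p → p⁻ p ∘ neg-⇒l)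
      (λ p → p⁺ p ∘ pos-⇒l) (≤-trans (m≤m⊔n (depth x) (depth y)) d) ¬t)
    atom-forces a∈ h (□ x) s p⁺ p⁻ (s≤s d) t (pair l b u b∈ g) (_ , r , adj) =
      atom-forces b∈ g x (s ∘ there) (λ p → p⁺ p ∘ pos-□) (λ p → p⁻ p ∘ neg-□)
        (next adj) (R-□ r (boxes⁺ φ (s (here refl))) t)
      where
      next : suc _ ≡ suc l ⊎ l ≡ suc (suc _) → depth x ≤ l
      -- One level down is paid for by the box removed; one level up only slackens the bound.
      next (inj₁ refl) = d
      next (inj₂ refl) = ≤-trans d (≤-trans (n≤1+n _) (n≤1+n _))
    -- A box forces a positive level, and `out` borders on level 0 alone.
    atom-forces a∈ h (□ x) s p⁺ p⁻ (s≤s d) t (out u) (_ , ())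

    atom-refutes a∈ h (var p) s p⁺ p⁻ d ¬t (f , _) = f (¬t , p⁺ p pos-var)
    atom-refutes a∈ h bot s p⁺ p⁻ d ¬t ()
    atom-refutes {a = a} a∈ h (x ⇒ y) s p⁺ p⁻ d ¬t f with a ⊨? x
    ... | yes t = atom-refutes a∈ h y (s ∘ ∈-++⁺ʳ (els x)) (λ p → p⁺ p ∘ pos-⇒r)
      (λ p → p⁻ p ∘ neg-⇒r) (≤-trans (m≤n⊔m (depth x) (depth y)) d)
      (λ t₁ → ¬t (⊨-⇒ λ _ → t₁))
      (f (atom-forces a∈ h x (s ∘ ∈-++⁺ˡ) (λ p → p⁻ p ∘ neg-⇒l)
        (λ p → p⁺ p ∘ pos-⇒l) (≤-trans (m≤m⊔n (depth x) (depth y)) d) t))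
    ... | no ¬t₁ = ¬t (⊨-⇒ λ t → contradiction t ¬t₁)
    -- The diamond in `θ` for this failing box gives a successor of `v` satisfying `θ k` of an atom
    -- that refutes `x`, hence an adjacent pair one level down.
    atom-refutes {suc k} {a} {v} a∈ h (□ x) s p⁺ p⁻ (s≤s d) ¬t f =
      conjunct (suc k) h diamond∈ λ u v↝u ¬⋁ → ¬⋁θ u v↝u ¬⋁
      where
      x∈ : x ∈ boxes φ
      x∈ = boxes⁺ φ (s (here refl))

      diamond∈ : ◇ ⋁ (map (θ k) (failures a x)) ∈ conjuncts (suc k) a
      diamond∈ = ∈-++⁺ʳ (literals a) (there (∈-map⁺ (λ χ → ◇ ⋁ (map (θ k) (failures a χ)))
        (∈-filter⁺ (λ χ → ¬? (a ⊨? □ χ)) x∈ ¬t)))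

      ¬⋁θ : ∀ u → v ↝ u → ¬ force N u (⋁ (map (θ k) (failures a x)))
      ¬⋁θ u v↝u ⋁θ = ⋁θ-elim {k} {as = failures a x} ⋁θ λ i g →
        let b∈ , r , ¬q = failures⁻ {a} i in
        atom-refutes b∈ g x (s ∘ there) (λ p → p⁺ p ∘ pos-□) (λ p → p⁻ p ∘ neg-□) d ¬q
          (f (pair k _ u b∈ g) (v↝u , r , inj₁ refl))

    -- A variable is overridden only by a signed literal of `a`; when its sign is not excluded by
    -- `P` or `Q` respectively, that literal is a conjunct of `θ`, so `v` already agrees. For boxes,
    -- `π-forces` projects steps along `π` and `forces-π` lifts steps of `N`.
    forces-π : ∀ w χ → (∀ p → Pos p χ → ¬ p ∈ P) → (∀ p → Neg p χ → ¬ p ∈ Q) →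
      force amalgam w χ → force N (π w) χ
    π-forces : ∀ w χ → (∀ p → Pos p χ → ¬ p ∈ Q) → (∀ p → Neg p χ → ¬ p ∈ P) →
      force N (π w) χ → force amalgam w χ

    forces-π (out v) (var p) p⁺ p⁻ f = f
    forces-π (pair k a v a∈ h) (var p) p⁺ p⁻ (_ , f) =
      V-stable v p λ ¬p → ¬p (f λ (t , i) → ¬p
        (conjunct k h (literals-conjuncts k (∈-++⁺ˡ (∈-map⁺ var
          (∈-filter⁺ (kept⁺? a) (posVars⁺ i) (t , p⁺ p pos-var)))))))
    forces-π w bot p⁺ p⁻ f = f
    forces-π w (x ⇒ y) p⁺ p⁻ f g =
      forces-π w y (λ p → p⁺ p ∘ pos-⇒r) (λ p → p⁻ p ∘ neg-⇒r)
        (f (π-forces w x (λ p → p⁻ p ∘ neg-⇒l) (λ p → p⁺ p ∘ pos-⇒l) g))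
    forces-π w (□ x) p⁺ p⁻ f u v↝u = force-stable N u x λ ¬x → lift w f v↝u
      λ w₁ eq g → ¬x (subst (λ u → force N u x) eq
        (forces-π w₁ x (λ p → p⁺ p ∘ pos-□) (λ p → p⁻ p ∘ neg-□) g))
      where
      -- At positive levels the box conjunct of `θ` supplies an atom for `u`; otherwise the copy of
      -- `u` serves. The atom is obtained only up to double negation, hence the refutation form.
      lift : ∀ w → force amalgam w (□ x) → π w ↝ u →
        ¬ (∀ w₁ → π w₁ ≡ u → ¬ force amalgam w₁ x)
      lift (out v) f r k = k (out u) refl (f (out u) (r , tt))
      lift (pair zero a v a∈ h) f r k = k (out u) refl (f (out u) (r , refl))
      lift (pair (suc n) a v a∈ h) f r k =
        ⋁θ-elim {n} {as = successors a}
          (conjunct (suc n) h (∈-++⁺ʳ (literals a) (here refl)) u r)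
          λ i g → let b∈ , ab = successors⁻ {a} i
                      w₁ = pair n _ u b∈ g
                  in k w₁ refl (f w₁ (r , ab , inj₁ refl))

    π-forces (out v) (var p) p⁺ p⁻ f = f
    π-forces (pair k a v a∈ h) (var p) p⁺ p⁻ f =
      (λ (¬t , i) → conjunct k h (literals-conjuncts k
        (∈-++⁺ʳ (map var (filter (kept⁺? a) (posVars φ))) (∈-map⁺ (neg ∘ var)
          (∈-filter⁺ (kept⁻? a) (negVars⁺ i) (¬t , p⁺ p pos-var))))) f) ,
      const f
    π-forces w bot p⁺ p⁻ f = f
    π-forces w (x ⇒ y) p⁺ p⁻ f g =
      π-forces w y (λ p → p⁺ p ∘ pos-⇒r) (λ p → p⁻ p ∘ neg-⇒r)
        (f (forces-π w x (λ p → p⁻ p ∘ neg-⇒l) (λ p → p⁺ p ∘ pos-⇒l) g))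
    π-forces w (□ x) p⁺ p⁻ f w₁ (r , _) =
      π-forces w₁ x (λ p → p⁺ p ∘ pos-□) (λ p → p⁻ p ∘ neg-□) (f (π w₁) r)

  -- The countermodel `N` comes from filtering through `interpolant ⇒ ψ`, not `φ`. Soundness of
  -- `φ ⇒ ψ` is applied at the pair over `v`, and `forces-π` carries `ψ` back to `v`.
  interpolant-uniform : ∀ ψ → (∀ p → Pos p ψ → ¬ p ∈ P) → (∀ p → Neg p ψ → ¬ p ∈ Q) →
    L ⊩ (φ ⇒ ψ) → L ⊩ (interpolant ⇒ ψ)
  interpolant-uniform ψ p⁺ p⁻ d with Canonical.completeness L (interpolant ⇒ ψ)
  ... | inj₁ proof = proof
  ... | inj₂ (N , v , ¬f) = ⊥-elim (¬f λ θv → force-stable N v ψ λ ¬ψ →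
    ⋁θ-elim {depth φ} {as = models} θv λ {a} i h →
      let a∈ , t = ∈-filter⁻ (_⊨? φ) i
          w = pair (depth φ) a v a∈ h
      in ¬ψ (forces-π w ψ p⁺ p⁻ (soundness d amalgam w
        (atom-forces a∈ h φ id (λ _ → id) (λ _ → id) ≤-refl t))))
    where open Amalgam N

  interpolant-ULI : IsULI L φ P Q interpolant
  interpolant-ULI =
    pos⊆ interpolant-within , neg⊆ interpolant-within , φ⇒interpolant , interpolant-uniform

theorem4p6 : (L : Logic) →
    ULIP L ×
    (∀ (φ : Fml) (P Q : List ℕ) →
    Σ Fml (λ θ → IsULI L φ P Q θ × depth θ ≤ depth φ))
theorem4p6 L =
  (λ φ P Q → let open Interpolant L φ P Q in interpolant , interpolant-ULI) ,
  (λ φ P Q → let open Interpolant L φ P Q in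
    interpolant , interpolant-ULI , depth≤ interpolant-within)
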